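{- For every $n,k,h \in \mathbb{Z}^+$ with $k \leq \binom{n}{2}$ and $0 \leq h < n$, there is a universal cycle for $\mathcal{W}_k^-(n,h)$.
   Context: $\mathcal{W}(n)$ denotes the set of weak orders on $[n]$ (transitive and complete relations), represented as words: $\mathcal{W}(n)$ is the set of all words $w_1w_2\ldots w_n$ of length $n$ over the nonnegative integers such that $\{w_1,\dots,w_n\} = \{0,1,\dots,h\}$ for some $h$ with $0 \le h \le n-1$ (here $w_j$ is the height of element $j$ in the weak order). This $h$, i.e. the maximum letter of $w$, is the height of $w$; the weight of $w$ is $\sum_{i=1}^n w_i$. $\mathcal{W}_k(n,h)$ is the set of $w \in \mathcal{W}(n)$ of height $h$ and weight $k$. The prefix of $w = w_1\ldots w_n$ is $w^- = w_1w_2\ldots w_{n-1}$, and $\mathcal{W}_k^-(n,h) = \{w^- \mid w \in \mathcal{W}_k(n,h)\}$, a set of strings of length $n-1$. Let $\mathcal{C}$ be a set of $N$ strings, each of length $m$. A universal cycle (ucycle) for $\mathcal{C}$ is a word $a_0a_1\ldots a_{N-1}$ such that each $c \in \mathcal{C}$ appears exactly once as a subword $a_{i+1}a_{i+2}\ldots a_{i+m}$ (one value of $i$ modulo $N$), where subscripts are taken modulo $N$. (In particular every such subword is a string in $\mathcal{C}$.) If $\mathcal{C}$ is empty ($N=0$), the empty word is a ucycle for $\mathcal{C}$. -}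

module Defs where

open import Data.Fin using (Fin; toℕ)
open import Data.Fin.Properties using (nonZeroIndex)
open import Data.List using (length)
import Data.List.Membership.Propositional as List
open import Data.List.Relation.Unary.Unique.Propositional using (Unique)
open import Data.Nat as ℕ using (ℕ; suc; pred; _+_; _≤_; _<_; NonZero)
open import Data.Nat.DivMod using (_mod_)
open import Data.Product using (∃-syntax; ∃!; _×_)
open import Data.Vec using (Vec; foldr′; init; lookup; sum; tabulate)
open import Data.Vec.Membership.Propositional using (_∈_)
open import Function using (_⇔_)
open import Level using (Level; 0ℓ; _⊔_)
open import Relation.Binary.PropositionalEquality using (_≡_)
open import Relation.Unary using (Pred)

private
  variable
    a ℓ : Level
    A : Set a
    m n : ℕ

-- A weak order on [n] is given by its word of heights; h < n renders
-- 0 ≤ h ≤ n - 1.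
IsWeakOrder : Pred (Vec ℕ n) 0ℓ
IsWeakOrder {n} w = ∃[ h ] h < n × (∀ x → x ∈ w ⇔ x ≤ h)

height : Vec ℕ n → ℕ
height = foldr′ ℕ._⊔_ 0

weight : Vec ℕ n → ℕ
weight = sum

𝒲 : (k n h : ℕ) → Pred (Vec ℕ n) 0ℓ
𝒲 k n h w = IsWeakOrder w × height w ≡ h × weight w ≡ k

𝒲⁻ : (k n h : ℕ) .{{_ : NonZero n}} → Pred (Vec ℕ (pred n)) 0ℓ
𝒲⁻ k (suc n) h u = ∃[ w ] 𝒲 k (suc n) h w × init w ≡ u

-- Sets are predicates, whose proofs need not be unique, so the elements are
-- counted by a duplicate-free listing rather than by a bijection with ∃ C.
HasCardinality : {A : Set a} → Pred A ℓ → ℕ → Set (a ⊔ ℓ)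
HasCardinality {A = A} C N =
  ∃[ xs ] Unique xs × length {A = A} xs ≡ N × (∀ c → c List.∈ xs ⇔ C c)

-- The subword s_{i+1} s_{i+2} … s_{i+m}, with subscripts modulo N.  It may
-- wrap around several times when m > N.
subword : ∀ {N} → Vec A N → Fin N → Vec A m
subword {N = N} s i = tabulate λ j → lookup s ((toℕ i + suc (toℕ j)) mod N)
  where instance _ = nonZeroIndex i

-- The length N of the word is required to be the number of strings in C, so
-- that unique occurrence of each c leaves no position for a string outside C.
IsUniversalCycle : {A : Set a} → Pred (Vec A m) ℓ → ∀ {N} → Vec A N → Set (a ⊔ ℓ)
IsUniversalCycle C {N} s =
  HasCardinality C N × (∀ c → C c → ∃! _≡_ λ i → subword s i ≡ c)

{-# OPTIONS --safe #-}
module Submission where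

-- Given the weight k, a word w of length n is determined by w⁻, so w can serve
-- as an arc from w₁…wₙ₋₂ to w₂…wₙ₋₁; universal cycles are then Eulerian circuits.
-- Rotation maps each arc to an arc following it, so the digraph is balanced, and
-- circuits are built by splicing rotation orbits into a walk closed under
-- rotation.  For connectivity, arcs with a common source differ by replacing the
-- last two letters x y by x′ y′ with x + y = x′ + y′.  Rotation carries this move
-- to any position; it contains the adjacent transpositions, hence all
-- permutations.  After sorting the letters 0, …, h to the front, the remaining
-- letters are matched one at a time by transferring units between them.

open import Data.Nat using (ℕ; _≤_; _<_; NonZero)
open import Data.Nat.Combinatorics using (_C_)
open import Data.Product using (∃-syntax)
open import Data.Vec using (Vec)
open import Defs

open import Data.Vec as Vec using ([]; _∷_)
import Data.Vec.Properties as Vec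
import Data.Vec.Membership.Propositional as Vec
open import Data.Vec.Membership.Propositional.Properties using (∈-toList⁺; ∈-toList⁻)
open import Data.Fin as Fin using (Fin; toℕ; inject₁)
import Data.Fin.Properties as Fin
open import Data.List as List using (List; []; _∷_; [_]; _++_; _∷ʳ_; length; applyUpTo; upTo)
import Data.List.Properties as List
open import Data.List.Membership.Propositional using (_∈_; _∉_)
open import Data.List.Membership.Propositional.Properties
open import Data.List.Relation.Binary.Permutation.Propositional
  using (_↭_; refl; prep; swap; trans; ↭-reflexive; ↭-sym; ↭-trans; ↭⇒↭ₛ)
open import Data.List.Relation.Binary.Permutation.Propositional.Properties
  using (All-resp-↭; ∈-resp-↭; ↭-length; shift; shifts; ++⁺ˡ; ++-comm; ∷↭∷ʳ)
open import Data.List.Relation.Binary.Permutation.Setoid.Properties using (Unique-resp-↭)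
open import Data.List.Relation.Unary.All as All using (All; []; _∷_)
import Data.List.Relation.Unary.All.Properties as All
open import Data.List.Relation.Unary.AllPairs using ([]; _∷_)
open import Data.List.Relation.Unary.Any using (here; there; index)
open import Data.List.Relation.Unary.Any.Properties using (lookup-index)
open import Data.List.Relation.Unary.Unique.Propositional using (Unique)
import Data.List.Relation.Unary.Unique.Propositional.Properties as Unique
open import Data.Nat using (zero; suc; pred; _+_; _∸_; z≤n; s≤s; s≤s⁻¹; _≤?_; _≟_)
open import Data.Nat.DivMod
open import Data.Nat.GeneralisedArithmetic using (iterate)
open import Data.Nat.ListAction using (sum)
open import Data.Nat.ListAction.Properties using (sum-++; sum-↭)
open import Data.Nat.Properties hiding (_≟_; _≤?_)
open import Data.Product using (_×_; _,_; proj₁; proj₂; ∃₂; ∃!)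
open import Data.Sum using (_⊎_; inj₁; inj₂; [_,_]′)
open import Function using (_∘_; _⇔_; mk⇔; Equivalence; id)
open import Level using (0ℓ)
open import Relation.Binary using (Rel; DecidableEquality)
open import Relation.Binary.Construct.Closure.Equivalence using (EqClosure; symmetric; return)
open import Relation.Binary.Construct.Closure.ReflexiveTransitive using (ε; _◅_; _◅◅_)
open import Relation.Binary.Construct.Closure.Symmetric using (fwd; bwd)
open import Relation.Binary.PropositionalEquality as ≡
  using (_≡_; _≢_; refl; sym; cong; cong₂; subst; subst₂; setoid; module ≡-Reasoning)
open import Relation.Nullary using (¬_; yes; no; contradiction)
open import Relation.Nullary.Decidable using (_×-dec_)
open import Relation.Unary using (Pred; Decidable)

-- Least witnesses and iterates.

least : ∀ {P : Pred ℕ 0ℓ} → Decidable P → ∀ m → P m → ∃[ q ] P q × (∀ {i} → i < q → ¬ P i)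
least P? m Pm with P? 0
... | yes P0 = 0 , P0 , λ ()
least P? zero    Pm | no ¬P0 = contradiction Pm ¬P0
least P? (suc m) Pm | no ¬P0 with q , Pq , min ← least (P? ∘ suc) m Pm =
  suc q , Pq , λ { {zero} _ → ¬P0 ; {suc i} (s≤s i<q) → min i<q }

iterate-+ : ∀ {A : Set} (f : A → A) x m n → iterate f x (m + n) ≡ iterate f (iterate f x m) n
iterate-+ f x zero    n = refl
iterate-+ f x (suc m) n = iterate-+ f (f x) m n

iterate-suc : ∀ {A : Set} (f : A → A) x m → iterate f x (suc m) ≡ f (iterate f x m)
iterate-suc f x zero    = refl
iterate-suc f x (suc m) = iterate-suc f (f x) m

-- Eulerian circuits by joining cycles.

-- A balanced digraph is given by its set Arc of arcs, the source map and a
-- permutation f of the arcs, of period p + 1, which sends each arc to one that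
-- can follow it: the target of an arc e is src (f e).
module CycleJoining
  {A V : Set} (_≟ᴬ_ : DecidableEquality A) (src : A → V) (f : A → A)
  (Arc : Pred A 0ℓ) (Arc-closed : ∀ {x} → Arc x → Arc (f x))
  (p : ℕ) (f-period : ∀ {x} → Arc x → iterate f x (suc p) ≡ x)
  where

  open import Data.List.Membership.DecPropositional _≟ᴬ_ using (_∈?_)

  data Walk (u : V) : List A → V → Set where
    []  : Walk u [] u
    _∷_ : ∀ {x xs v} → src x ≡ u → Walk (src (f x)) xs v → Walk u (x ∷ xs) v

  walk-++ : ∀ {u v w xs ys} → Walk u xs v → Walk v ys w → Walk u (xs ++ ys) w
  walk-++ []         ys = ys
  walk-++ (eq ∷ xs) ys = eq ∷ walk-++ xs ys

  walk-insert : ∀ {u v} xs {e ys zs} → Walk u (xs ++ e ∷ zs) v →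
                Walk (src (f e)) ys (src (f e)) → Walk u (xs ++ e ∷ ys ++ zs) v
  walk-insert []       (eq ∷ w) w′ = eq ∷ walk-++ w′ w
  walk-insert (x ∷ xs) (eq ∷ w) w′ = eq ∷ walk-insert xs w w′

  walk-orbit : ∀ x q → Walk (src x) (applyUpTo (iterate f x) q) (src (iterate f x q))
  walk-orbit x zero    = []
  walk-orbit x (suc q) = refl ∷ walk-orbit (f x) q

  walk-step : ∀ {u v xs} → Walk u xs v → (i j : Fin (length xs)) → toℕ j ≡ suc (toℕ i) →
              src (f (List.lookup xs i)) ≡ src (List.lookup xs j)
  walk-step (_ ∷ (eq ∷ w)) Fin.zero    (Fin.suc Fin.zero) _ = sym eq
  walk-step (_ ∷ w)        (Fin.suc i) (Fin.suc j)        q = walk-step w i j (suc-injective q)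

  walk-end : ∀ {u v xs} → Walk u xs v → (i : Fin (length xs)) → suc (toℕ i) ≡ length xs →
             src (f (List.lookup xs i)) ≡ v
  walk-end (_ ∷ [])      Fin.zero    _ = refl
  walk-end (_ ∷ (_ ∷ _)) Fin.zero    ()
  walk-end (_ ∷ w)       (Fin.suc i) q = walk-end w i (suc-injective q)

  -- Closure under `f` makes the arcs a union of whole orbits, so an orbit is either contained in a
  -- circuit or disjoint from it.
  record Circuit : Set where
    field
      {vertex} : V
      arcs     : List A
      walk     : Walk vertex arcs vertex
      unique   : Unique arcs
      all-Arc  : All Arc arcs
      closed   : ∀ {x} → x ∈ arcs → f x ∈ arcs

    closed-iterate : ∀ {x} n → x ∈ arcs → iterate f x n ∈ arcs
    closed-iterate zero    x∈ = x∈
    closed-iterate (suc n) x∈ = closed-iterate n (closed x∈)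

    -- On arcs `f` has period p + 1, so its p-th iterate inverts it.
    closed⁻ : ∀ {x} → Arc x → f x ∈ arcs → x ∈ arcs
    closed⁻ Ax fx∈ = subst (_∈ arcs) (f-period Ax) (closed-iterate p fx∈)

  open Circuit

  Arc-iterate : ∀ {x} n → Arc x → Arc (iterate f x n)
  Arc-iterate zero    Ax = Ax
  Arc-iterate (suc n) Ax = Arc-iterate n (Arc-closed Ax)

  module _ {x : A} (Ax : Arc x) where

    private
      -- The search runs over i with period i + 1, which excludes the trivial period 0; the least
      -- period is q + 1.
      least-period = least (λ i → iterate f x (suc i) ≟ᴬ x) p (f-period Ax)
      q   = proj₁ least-period
      fq  = proj₁ (proj₂ least-period)
      min = proj₂ (proj₂ least-period)

    -- If fⁱ x = fʲ x with i < j ≤ q, applying f^(q + 1 − j) gives a period below q + 1.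
    orbit-distinct : ∀ {i j} → i < j → j < suc q → iterate f x i ≢ iterate f x j
    orbit-distinct {i} {j} i<j (s≤s j≤q) eq = min smaller (begin
      iterate f x (suc (i + (q ∸ j)))           ≡⟨ cong (iterate f x) (+-suc i (q ∸ j)) ⟨
      iterate f x (i + suc (q ∸ j))             ≡⟨ iterate-+ f x i _ ⟩
      iterate f (iterate f x i) (suc (q ∸ j))   ≡⟨ cong (λ y → iterate f y (suc (q ∸ j))) eq ⟩
      iterate f (iterate f x j) (suc (q ∸ j))   ≡⟨ iterate-+ f x j _ ⟨
      iterate f x (j + suc (q ∸ j))             ≡⟨ cong (iterate f x) (+-suc j (q ∸ j)) ⟩
      iterate f x (suc (j + (q ∸ j)))           ≡⟨ cong (iterate f x ∘ suc) (m+[n∸m]≡n j≤q) ⟩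
      iterate f x (suc q)                       ≡⟨ fq ⟩
      x                                         ∎)
      where
      open ≡-Reasoning
      smaller : i + (q ∸ j) < q
      smaller = subst (i + (q ∸ j) <_) (m+[n∸m]≡n j≤q) (+-monoˡ-< (q ∸ j) i<j)

    orbit : Circuit
    orbit .vertex = src x
    orbit .arcs   = applyUpTo (iterate f x) (suc q)
    orbit .walk   = subst (Walk _ _) (cong src fq) (walk-orbit x (suc q))
    orbit .unique = Unique.applyUpTo⁺₁ (iterate f x) (suc q) orbit-distinct
    orbit .all-Arc = All.applyUpTo⁺₂ (iterate f x) (suc q) (λ i → Arc-iterate i Ax)
    orbit .closed {y} y∈ with ∈-applyUpTo⁻ (iterate f x) y∈
    ... | i , s≤s i≤q , refl with m≤n⇒m<n∨m≡n i≤q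
    ...   | inj₁ i<q  = subst (_∈ applyUpTo (iterate f x) (suc q)) (iterate-suc f x i)
                          (∈-applyUpTo⁺ (iterate f x) (s≤s i<q))
    -- The image of the last arc of the orbit is its first arc.
    ...   | inj₂ refl = here (≡.trans (sym (iterate-suc f x i)) fq)

    -- From a common arc fⁱ x, another q + 1 - i steps lead back to `x`, so `T` would contain `x`.
    orbit-disjoint : (T : Circuit) → x ∉ arcs T → ∀ {y} → ¬ (y ∈ arcs T × y ∈ arcs orbit)
    orbit-disjoint T x∉ (y∈T , y∈o)
      with i , s≤s i≤q , refl ← ∈-applyUpTo⁻ (iterate f x) y∈o =
      contradiction (subst (_∈ arcs T) back (closed-iterate T (suc q ∸ i) y∈T)) x∉
      where
      back : iterate f (iterate f x i) (suc q ∸ i) ≡ x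
      back = ≡.trans (sym (iterate-+ f x i _))
               (≡.trans (cong (iterate f x) (m+[n∸m]≡n (m≤n⇒m≤1+n i≤q))) fq)

  record _⊑_ (S T : Circuit) : Set where
    constructor mk⊑
    field sub : ∀ {x} → x ∈ arcs S → x ∈ arcs T

  -- The orbit of x is spliced in right after the arc e.
  splice : (T : Circuit) → ∀ {e x} → e ∈ arcs T → Arc x → src (f e) ≡ src x →
           ∃[ T′ ] T ⊑ T′ × x ∈ arcs T′
  splice T {e} {x} e∈ Ax eq with x ∈? arcs T
  ... | yes x∈ = T , mk⊑ id , x∈
  ... | no  x∉ with ys , zs , arcs≡ ← ∈-∃++ e∈ =
    T′ , mk⊑ (λ y∈ → from (inj₂ y∈)) , from (inj₁ (here refl))
    where
    O = orbit Ax
    new = ys ++ e ∷ arcs O ++ zs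
    -- Uniqueness, membership and closure do not depend on the order of the arcs, so they are
    -- transferred from the disjoint union along this permutation.
    perm : arcs O ++ arcs T ↭ new
    perm = ↭-trans (++⁺ˡ (arcs O) (↭-trans (↭-reflexive arcs≡) (↭-reflexive (sym (List.++-assoc ys [ e ] zs)))))
             (↭-trans (shifts (arcs O) (ys ∷ʳ e)) (↭-reflexive (List.++-assoc ys [ e ] (arcs O ++ zs))))
    from : ∀ {y} → y ∈ arcs O ⊎ y ∈ arcs T → y ∈ new
    from = ∈-resp-↭ perm ∘ [ ∈-++⁺ˡ , ∈-++⁺ʳ (arcs O) ]′
    to : ∀ {y} → y ∈ new → y ∈ arcs O ⊎ y ∈ arcs T
    to = ∈-++⁻ (arcs O) ∘ ∈-resp-↭ (↭-sym perm)
    disj : ∀ {y} → ¬ (y ∈ arcs O × y ∈ arcs T)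
    disj (y∈O , y∈T) = orbit-disjoint Ax T x∉ (y∈T , y∈O)
    T′ : Circuit
    T′ .vertex = _
    T′ .arcs   = new
    T′ .walk   = walk-insert ys (subst (λ as → Walk (vertex T) as (vertex T)) arcs≡ (walk T))
                   (subst (λ v → Walk v (arcs O) v) (sym eq) (walk O))
    T′ .unique = Unique-resp-↭ (setoid A) (↭⇒↭ₛ perm) (Unique.++⁺ (unique O) (unique T) disj)
    T′ .all-Arc = All-resp-↭ perm (All.++⁺ (all-Arc O) (all-Arc T))
    T′ .closed y∈ = from ([ inj₁ ∘ closed O , inj₂ ∘ closed T ]′ (to y∈))

  -- These steps express connectivity. Only `branch` can lead out of a circuit, since circuits are
  -- closed under `f` in both directions.
  data Adjacent (x y : A) : Set where
    rotate : Arc x → y ≡ f x → Adjacent x y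
    branch : Arc x → Arc y → src x ≡ src y → Adjacent x y

  -- Splicing needs an arc of `T` that ends at the source of `y`. The predecessor of `x` under `f`,
  -- its p-th iterate, is one.
  branch-extend : (T : Circuit) → ∀ {x y} → x ∈ arcs T → Arc x → Arc y → src x ≡ src y →
                  ∃[ T′ ] T ⊑ T′ × y ∈ arcs T′
  branch-extend T {x} x∈ Ax Ay eq = splice T (closed-iterate T p x∈) Ay
    (≡.trans (cong src (≡.trans (sym (iterate-suc f x p)) (f-period Ax))) eq)

  extend : ∀ {x y} → EqClosure Adjacent x y → (T : Circuit) → x ∈ arcs T →
           ∃[ T′ ] T ⊑ T′ × y ∈ arcs T′
  extend ε T x∈ = T , mk⊑ id , x∈
  extend (fwd (rotate _ refl) ◅ c)   T x∈ = extend c T (closed T x∈)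
  extend (bwd (rotate Ay refl) ◅ c)  T x∈ = extend c T (closed⁻ T Ay x∈)
  extend (fwd (branch Ax Ay eq) ◅ c) T x∈
    with T₁ , mk⊑ s₁ , y∈ ← branch-extend T x∈ Ax Ay eq
    with T₂ , mk⊑ s₂ , z∈ ← extend c T₁ y∈ = T₂ , mk⊑ (s₂ ∘ s₁) , z∈
  extend (bwd (branch Ay Ax eq) ◅ c) T x∈
    with T₁ , mk⊑ s₁ , y∈ ← branch-extend T x∈ Ax Ay (sym eq)
    with T₂ , mk⊑ s₂ , z∈ ← extend c T₁ y∈ = T₂ , mk⊑ (s₂ ∘ s₁) , z∈

  module _ (connected : ∀ {x y} → Arc x → Arc y → EqClosure Adjacent x y) where

    cover : ∀ {x} → Arc x → (T : Circuit) → x ∈ arcs T → ∀ {ys} → All Arc ys →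
            ∃[ T′ ] T ⊑ T′ × All (_∈ arcs T′) ys
    cover Ax T x∈ []         = T , mk⊑ id , []
    cover Ax T x∈ (Ay ∷ Ays)
      with T₁ , mk⊑ s₁ , y∈  ← extend (connected Ax Ay) T x∈
      with T₂ , mk⊑ s₂ , ys∈ ← cover Ax T₁ (s₁ x∈) Ays = T₂ , mk⊑ (s₂ ∘ s₁) , s₂ y∈ ∷ ys∈

    -- If there is an arc, its orbit is grown until it contains all arcs. Otherwise the circuit is
    -- empty, and `v₀` serves as its vertex.
    eulerian : V → Decidable Arc → ∀ ys → (∀ {x} → Arc x → x ∈ ys) →
               ∃[ T ] (∀ x → x ∈ arcs T ⇔ Arc x)
    eulerian v₀ Arc? ys complete =
      go (List.filter Arc? ys) (All.all-filter Arc? ys) (λ Ax → ∈-filter⁺ Arc? (complete Ax) Ax)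
      where
      go : ∀ zs → All Arc zs → (∀ {x} → Arc x → x ∈ zs) → ∃[ T ] (∀ x → x ∈ arcs T ⇔ Arc x)
      go []       _          complete = empty , λ x → mk⇔ (λ ()) complete
        where
        empty : Circuit
        empty = record { vertex = v₀ ; arcs = [] ; walk = [] ; unique = [] ; all-Arc = [] ; closed = λ () }
      go (z ∷ zs) (Az ∷ Azs) complete
        with T , _ , zs∈ ← cover Az (orbit Az) (here refl) (Az ∷ Azs) =
        T , λ x → mk⇔ (All.lookup (all-Arc T)) (All.lookup zs∈ ∘ complete)

-- Words as lists: prefixes, rotations and rearrangements.

-- Padding with 0 makes this total on lists, so that sources are defined for all of them.
prefix : ∀ m → List ℕ → Vec ℕ m
prefix zero    _        = []
prefix (suc m) []       = 0 ∷ prefix m []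
prefix (suc m) (x ∷ xs) = x ∷ prefix m xs

prefix-++ : ∀ {m} xs {ys} → m ≤ length xs → prefix m (xs ++ ys) ≡ prefix m xs
prefix-++ {zero}  xs       _ = refl
prefix-++ {suc m} (x ∷ xs) l = cong (x ∷_) (prefix-++ xs (s≤s⁻¹ l))

init-prefix : ∀ m xs → Vec.init (prefix (suc m) xs) ≡ prefix m xs
init-prefix zero    []       = refl
init-prefix zero    (x ∷ xs) = refl
init-prefix (suc m) []       = cong (0 ∷_) (init-prefix m [])
init-prefix (suc m) (x ∷ xs) = cong (x ∷_) (init-prefix m xs)

-- The last letter is the weight minus the sum of the others.
prefix-sum-injective : ∀ m {xs ys} → length xs ≡ suc m → length ys ≡ suc m →
                       prefix m xs ≡ prefix m ys → sum xs ≡ sum ys → xs ≡ ys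
prefix-sum-injective zero {x ∷ []} {y ∷ []} _ _ _ eq =
  cong [_] (+-cancelʳ-≡ 0 x y eq)
prefix-sum-injective (suc m) {x ∷ xs} {y ∷ ys} lx ly pre eq
  with refl ← Vec.∷-injectiveˡ pre =
  cong (x ∷_) (prefix-sum-injective m (suc-injective lx) (suc-injective ly)
                 (Vec.∷-injectiveʳ pre) (+-cancelˡ-≡ x _ _ eq))

rot : List ℕ → List ℕ
rot []       = []
rot (x ∷ xs) = xs ∷ʳ x

rot-↭ : ∀ xs → xs ↭ rot xs
rot-↭ []       = refl
rot-↭ (x ∷ xs) = ∷↭∷ʳ x xs

-- The letters moved so far accumulate at the end of `ys`, which is therefore arbitrary in the
-- induction.
iterate-rot : ∀ xs ys → iterate rot (xs ++ ys) (length xs) ≡ ys ++ xs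
iterate-rot []       ys = sym (List.++-identityʳ ys)
iterate-rot (x ∷ xs) ys = begin
  iterate rot ((xs ++ ys) ∷ʳ x) (length xs)
    ≡⟨ cong (λ zs → iterate rot zs (length xs)) (List.++-assoc xs ys [ x ]) ⟩
  iterate rot (xs ++ ys ∷ʳ x) (length xs)   ≡⟨ iterate-rot xs (ys ∷ʳ x) ⟩
  ys ∷ʳ x ++ xs                             ≡⟨ List.++-assoc ys [ x ] xs ⟩
  ys ++ x ∷ xs                              ∎
  where open ≡-Reasoning

-- The string w⁻ of an arc ends with the target of the arc: the letter that `rot` moves to the end
-- lies beyond the prefix.
tail-prefix : ∀ m {xs} → length xs ≡ suc (suc m) → Vec.tail (prefix (suc m) xs) ≡ prefix m (rot xs)
tail-prefix m {x ∷ xs} l = sym (prefix-++ xs (≤-trans (n≤1+n m) (≤-reflexive (sym (suc-injective l)))))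

∈-delete : ∀ {b c : ℕ} ys {zs} → b ≢ c × c ∈ ys ++ [ b ] ++ zs → c ∈ ys ++ zs
∈-delete {b} ys {zs} (b≢c , c∈) with ∈-resp-↭ (shift b ys zs) c∈
... | here c≡b  = contradiction (sym c≡b) b≢c
... | there c∈′ = c∈′

-- Since the members of `bs` are distinct, deleting one occurrence of `b` from `xs` leaves the
-- others present.
split-off : ∀ {bs xs : List ℕ} → Unique bs → All (_∈ xs) bs → ∃[ ys ] xs ↭ bs ++ ys
split-off {xs = xs} []         []          = xs , refl
split-off {b ∷ bs}  (b∉ ∷ ubs) (b∈ ∷ bs∈)
  with ys , zs , refl ← ∈-∃++ b∈
  with rs , perm ← split-off ubs (All.zipWith (∈-delete ys) (b∉ , bs∈)) =
  rs , ↭-trans (shift b ys zs) (prep b perm)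

-- Supplies the letter from which a unit can be taken.
positive-entry : ∀ xs {d} → suc d ≤ sum xs → ∃₂ λ b ys → xs ↭ suc b ∷ ys
positive-entry (zero ∷ xs)  d< with b , ys , perm ← positive-entry xs d< =
  b , 0 ∷ ys , ↭-trans (prep 0 perm) (swap 0 (suc b) refl)
positive-entry (suc b ∷ xs) _  = b , xs , refl

bounded-words : ℕ → ℕ → List (List ℕ)
bounded-words h zero    = [ [] ]
bounded-words h (suc n) = List.cartesianProductWith _∷_ (upTo (suc h)) (bounded-words h n)

bounded-words-complete : ∀ {h} xs → All (_≤ h) xs → xs ∈ bounded-words h (length xs)
bounded-words-complete []       []        = here refl
bounded-words-complete (x ∷ xs) (x≤ ∷ xs≤) =
  ∈-cartesianProductWith⁺ _∷_ (∈-upTo⁺ (s≤s x≤)) (bounded-words-complete xs xs≤)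

-- Connectivity of the digraph of words.

module Words (p k h : ℕ) where

  open import Data.List.Membership.DecPropositional _≟_ using (_∈?_)

  -- Arcs are words of length p + 2, vertices have length p, and the strings of the universal cycle
  -- have length p + 1.
  n : ℕ
  n = suc (suc p)

  letters : List ℕ
  letters = upTo (suc h)

  -- The list form of `𝒲 k n h`. Quantifying over finite lists makes it decidable and easy to
  -- transport along permutations.
  Word : Pred (List ℕ) 0ℓ
  Word xs = length xs ≡ n × All (_≤ h) xs × All (_∈ xs) letters × sum xs ≡ k

  word? : Decidable Word
  word? xs = length xs ≟ n ×-dec All.all? (_≤? h) xs ×-dec All.all? (_∈? xs) letters ×-dec sum xs ≟ k

  word-↭ : ∀ {xs ys} → xs ↭ ys → Word xs → Word ys
  word-↭ perm (len , bound , onto , wt) =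
    ≡.trans (sym (↭-length perm)) len , All-resp-↭ perm bound ,
    All.map (∈-resp-↭ perm) onto , ≡.trans (sym (sum-↭ perm)) wt

  word-rot : ∀ {xs} → Word xs → Word (rot xs)
  word-rot {xs} = word-↭ (rot-↭ xs)

  rot-period : ∀ {xs} → Word xs → iterate rot xs n ≡ xs
  rot-period {xs} (len , _) = begin
    iterate rot xs n                    ≡⟨ cong₂ (iterate rot) (List.++-identityʳ xs) len ⟨
    iterate rot (xs ++ []) (length xs)  ≡⟨ iterate-rot xs [] ⟩
    xs                                  ∎
    where open ≡-Reasoning

  -- The argument `suc p` stands for the period p + 2, which is `n`.
  open CycleJoining (List.≡-dec _≟_) (prefix p) rot Word word-rot (suc p) rot-period public

  _~_ : Rel (List ℕ) 0ℓ
  _~_ = EqClosure Adjacent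

  ~-reflexive : ∀ {xs ys} → xs ≡ ys → xs ~ ys
  ~-reflexive refl = ε

  ~-sym : ∀ {xs ys} → xs ~ ys → ys ~ xs
  ~-sym = symmetric Adjacent

  ~-iterate : ∀ {xs} → Word xs → ∀ i → xs ~ iterate rot xs i
  ~-iterate w zero    = ε
  ~-iterate w (suc i) = fwd (rotate w refl) ◅ ~-iterate (word-rot w) i

  ~-rotate : ∀ xs ys → Word (xs ++ ys) → (xs ++ ys) ~ (ys ++ xs)
  ~-rotate xs ys w = subst ((xs ++ ys) ~_) (iterate-rot xs ys) (~-iterate w (length xs))

  ~-to-end : ∀ us as vs → Word (us ++ as ++ vs) → (us ++ as ++ vs) ~ ((vs ++ us) ++ as)
  ~-to-end us as vs w =
    ~-reflexive (sym assoc₁) ◅◅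
    ~-rotate (us ++ as) vs (subst Word (sym assoc₁) w) ◅◅
    ~-reflexive (sym (List.++-assoc vs us as))
    where assoc₁ = List.++-assoc us as vs

  -- Once the pair is rotated to the end, the two words agree in their first p letters and are arcs
  -- with a common source.
  ~-pair : ∀ us {x y x′ y′} vs → x + y ≡ x′ + y′ →
           Word (us ++ x ∷ y ∷ vs) → Word (us ++ x′ ∷ y′ ∷ vs) →
           (us ++ x ∷ y ∷ vs) ~ (us ++ x′ ∷ y′ ∷ vs)
  ~-pair us {x} {y} {x′} {y′} vs eq w w′ =
    ~-to-end us (x ∷ y ∷ []) vs w ◅◅
    return (branch (to-end w) (to-end w′) (≡.trans (prefix-++ (vs ++ us) long) (sym (prefix-++ (vs ++ us) long)))) ◅◅
    ~-sym (~-to-end us (x′ ∷ y′ ∷ []) vs w′)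
    where
    to-end : ∀ {a b} → Word (us ++ a ∷ b ∷ vs) → Word ((vs ++ us) ++ a ∷ b ∷ [])
    to-end {a} {b} = word-↭ (↭-trans (↭-reflexive (sym (List.++-assoc us (a ∷ b ∷ []) vs)))
      (↭-trans (++-comm (us ++ a ∷ b ∷ []) vs) (↭-reflexive (sym (List.++-assoc vs us _)))))
    long : p ≤ length (vs ++ us)
    long = ≤-reflexive (suc-injective (suc-injective (begin
      n                                         ≡⟨ proj₁ (to-end w) ⟨
      length ((vs ++ us) ++ x ∷ y ∷ [])         ≡⟨ List.length-++ (vs ++ us) ⟩
      length (vs ++ us) + 2                     ≡⟨ +-comm _ 2 ⟩
      2 + length (vs ++ us)                     ∎)))
      where open ≡-Reasoning

  -- A swap is a pair move with x + y = y + x. Since moves act on whole words, `us` collects the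
  -- letters already passed.
  ~-↭ : ∀ {xs ys} → xs ↭ ys → Word xs → xs ~ ys
  ~-↭ = under []
    where
    under : ∀ us {xs ys} → xs ↭ ys → Word (us ++ xs) → (us ++ xs) ~ (us ++ ys)
    under us refl         w = ε
    under us (prep {xs} {ys} x perm) w = subst₂ _~_ (List.++-assoc us [ x ] xs) (List.++-assoc us [ x ] ys)
      (under (us ∷ʳ x) perm (subst Word (sym (List.++-assoc us [ x ] xs)) w))
    under us (swap {xs} {ys} x y perm) w =
      ~-pair us xs (+-comm x y) w w′ ◅◅
      subst₂ _~_ (List.++-assoc us (y ∷ x ∷ []) xs) (List.++-assoc us (y ∷ x ∷ []) ys)
        (under (us ++ y ∷ x ∷ []) perm (subst Word (sym (List.++-assoc us (y ∷ x ∷ []) xs)) w′))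
      where w′ = word-↭ (++⁺ˡ us (swap x y refl)) w
    under us (trans p q)  w = under us p w ◅◅ under us q (word-↭ (++⁺ˡ us p) w)

  module _ {us : List ℕ} (us-onto : All (_∈ us) letters) where

    -- All letters 0, ..., h occur in `us`, so the rest may change freely within the bound, at fixed
    -- length and sum.
    replace : ∀ {xs ys} → Word (us ++ xs) → length xs ≡ length ys → sum xs ≡ sum ys →
              All (_≤ h) ys → Word (us ++ ys)
    replace {xs} {ys} (len , bound , _ , wt) len≡ sum≡ ys≤ =
      ≡.trans (≡.trans (List.length-++ us) (≡.trans (cong (length us +_) (sym len≡)) (sym (List.length-++ us)))) len ,
      All.++⁺ (All.++⁻ˡ us bound) ys≤ ,
      All.map ∈-++⁺ˡ us-onto ,
      ≡.trans (≡.trans (sum-++ us ys) (≡.trans (cong (sum us +_) (sym sum≡)) (sym (sum-++ us xs)))) wt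

    -- A positive letter is brought next to `a` and gives it one unit, `d` times. The bound on
    -- `sum xs` guarantees that units remain, and a + d ≤ h that the letter stays admissible.
    raise : ∀ d {a xs} → Word (us ++ a ∷ xs) → a + d ≤ h → d ≤ sum xs →
            ∃[ ys ] (us ++ a ∷ xs) ~ (us ++ (a + d) ∷ ys) × Word (us ++ (a + d) ∷ ys)
    raise zero {a} {xs} w _ _ rewrite +-identityʳ a = xs , ε , w
    raise (suc d) {a} {xs} w a+d≤h d<
      with b , ys , perm ← positive-entry xs d<
      rewrite +-suc a d
      with perm′ ← ++⁺ˡ us (prep a perm)
      with w₁@(_ , bound , _) ← word-↭ perm′ w
      with _ ∷ sb≤h ∷ ys≤h ← All.++⁻ʳ us bound
      with w₂ ← replace w₁ refl (+-suc a (b + sum ys))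
                  (≤-trans (s≤s (m≤m+n a d)) a+d≤h ∷ ≤-trans (n≤1+n b) sb≤h ∷ ys≤h)
      with zs , c , w₃ ← raise d w₂ a+d≤h (s≤s⁻¹ (subst (suc d ≤_) (sum-↭ perm) d<)) =
      zs , ~-↭ perm′ w ◅◅ ~-pair us ys (+-suc a b) w₁ w₂ ◅◅ c , w₃

  same-length : ∀ us {xs ys} → Word (us ++ xs) → Word (us ++ ys) → length xs ≡ length ys
  same-length us (len , _) (len′ , _) = +-cancelˡ-≡ (length us) _ _
    (≡.trans (sym (List.length-++ us)) (≡.trans (≡.trans len (sym len′)) (List.length-++ us)))

  same-sum : ∀ us {xs ys} → Word (us ++ xs) → Word (us ++ ys) → sum xs ≡ sum ys
  same-sum us (_ , _ , _ , wt) (_ , _ , _ , wt′) = +-cancelˡ-≡ (sum us) _ _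
    (≡.trans (sym (sum-++ us _)) (≡.trans (≡.trans wt (sym wt′)) (sum-++ us _)))

  mutual

    -- Recursion is on the length `l`, because the tail produced by `raise` is not a subterm of `xs`
    -- and the two words may exchange roles.
    same-base : ∀ l us xs ys → length xs ≡ l → All (_∈ us) letters →
                Word (us ++ xs) → Word (us ++ ys) → (us ++ xs) ~ (us ++ ys)
    same-base l       us []       []       len onto w w′ = ε
    same-base l       us []       (y ∷ ys) len onto w w′ with () ← same-length us w w′
    same-base l       us (x ∷ xs) []       len onto w w′ with () ← same-length us w w′
    same-base (suc l) us (x ∷ xs) (y ∷ ys) len onto w w′ with ≤-total x y
    ... | inj₁ x≤y = heads-≤ l (suc-injective len) onto x≤y w w′
    ... | inj₂ y≤x =
      ~-sym (heads-≤ l (suc-injective (≡.trans (same-length us w′ w) len)) onto y≤x w′ w)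

    heads-≤ : ∀ l {us x xs y ys} → length xs ≡ l → All (_∈ us) letters → x ≤ y →
              Word (us ++ x ∷ xs) → Word (us ++ y ∷ ys) → (us ++ x ∷ xs) ~ (us ++ y ∷ ys)
    heads-≤ l {us} {x} {xs} {y} {ys} len onto x≤y w w′@(_ , bound , _)
      with d , refl ← m≤n⇒∃[o]m+o≡n x≤y
      -- Equal weights give `sum xs` = d + `sum ys`, so the tail holds the `d` units missing from
      -- `x`. The common head then joins the base.
      with sum≡ ← +-cancelˡ-≡ x _ _ (≡.trans (same-sum us w w′) (+-assoc x d (sum ys)))
      with zs , c , w₁ ← raise onto d w (All.head (All.++⁻ʳ us bound))
                           (subst (d ≤_) (sym sum≡) (m≤m+n d (sum ys))) =
      c ◅◅ subst₂ _~_ (List.++-assoc us [ _ ] zs) (List.++-assoc us [ _ ] ys)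
             (same-base l (us ∷ʳ _) zs ys (≡.trans (suc-injective (same-length us w₁ w)) len)
                (All.map ∈-++⁺ˡ onto)
                (subst Word (sym (List.++-assoc us [ _ ] zs)) w₁)
                (subst Word (sym (List.++-assoc us [ _ ] ys)) w′))

  connected : ∀ {xs ys} → Word xs → Word ys → xs ~ ys
  connected w@(_ , _ , onto , _) w′@(_ , _ , onto′ , _)
    with rs , perm  ← split-off (Unique.upTo⁺ (suc h)) onto
    with ss , perm′ ← split-off (Unique.upTo⁺ (suc h)) onto′ =
    ~-↭ perm w ◅◅
    same-base (length rs) letters rs ss refl (All.tabulate id) (word-↭ perm w) (word-↭ perm′ w′) ◅◅
    ~-sym (~-↭ perm′ w′)

  circuit : ∃[ T ] (∀ xs → xs ∈ Circuit.arcs T ⇔ Word xs)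
  circuit = eulerian connected (prefix p []) word? (bounded-words h n)
    λ {xs} (len , bound , _) → subst (λ m → xs ∈ bounded-words h m) len (bounded-words-complete xs bound)

-- Cyclic indices and words with prescribed windows.

mod-cong : ∀ {i j N} .{{_ : NonZero N}} → i % N ≡ j % N → i mod N ≡ j mod N
mod-cong {i} {j} {N} eq = Fin.fromℕ<-cong _ _ eq (m%n<n i N) (m%n<n j N)

toℕ-mod : ∀ i N .{{_ : NonZero N}} → toℕ (i mod N) ≡ i % N
toℕ-mod i N = Fin.toℕ-fromℕ< (m%n<n i N)

toℕ-mod-id : ∀ {N} .{{_ : NonZero N}} (i : Fin N) → toℕ i mod N ≡ i
toℕ-mod-id {N} i = Fin.toℕ-injective (≡.trans (toℕ-mod (toℕ i) N) (m<n⇒m%n≡m (Fin.toℕ<n i)))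

[m%n+o]%n≡[m+o]%n : ∀ m n o .{{_ : NonZero n}} → (m % n + o) % n ≡ (m + o) % n
[m%n+o]%n≡[m+o]%n m n o = begin
  (m % n + o) % n          ≡⟨ %-distribˡ-+ (m % n) o n ⟩
  (m % n % n + o % n) % n  ≡⟨ cong (λ r → (r + o % n) % n) (m%n%n≡m%n m n) ⟩
  (m % n + o % n) % n      ≡⟨ %-distribˡ-+ m o n ⟨
  (m + o) % n              ∎
  where open ≡-Reasoning

[1+m%n]%n≡[1+m]%n : ∀ m n .{{_ : NonZero n}} → suc (m % n) % n ≡ suc m % n
[1+m%n]%n≡[1+m]%n m n = begin
  suc (m % n) % n  ≡⟨ cong (_% n) (+-comm 1 (m % n)) ⟩
  (m % n + 1) % n  ≡⟨ [m%n+o]%n≡[m+o]%n m n 1 ⟩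
  (m + 1) % n      ≡⟨ cong (_% n) (+-comm m 1) ⟩
  suc m % n        ∎
  where open ≡-Reasoning

lookup-init : ∀ {A : Set} {m} (v : Vec A (suc m)) j → Vec.lookup (Vec.init v) j ≡ Vec.lookup v (inject₁ j)
lookup-init (x ∷ y ∷ v) Fin.zero    = refl
lookup-init (x ∷ y ∷ v) (Fin.suc j) = lookup-init (y ∷ v) j

-- Windows that overlap their successors in all but one letter are the subwords of a single cyclic
-- word, formed by their heads. Indexing by ℕ with period N avoids case distinctions at the wrap.
module OverlappingWindows {A : Set} {m N : ℕ} .{{_ : NonZero N}} (E : ℕ → Vec A (suc m))
  (periodic : ∀ {i j} → i % N ≡ j % N → E i ≡ E j)
  (step     : ∀ i → Vec.tail (E i) ≡ Vec.init (E (suc i)))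
  where

  open ≡-Reasoning

  -- A letter moves one place to the left from each window to the next, until it is the head. The
  -- induction is on `t`, since `inject₁ j` is not a subterm.
  lookup-window : ∀ t i j → toℕ j ≡ t → Vec.lookup (E i) j ≡ Vec.head (E (i + t))
  lookup-window zero i Fin.zero _ with E i | E (i + 0) | cong E (+-identityʳ i)
  ... | x ∷ v | _ | refl = refl
  lookup-window (suc t) i (Fin.suc j) eq = begin
    Vec.lookup (E i) (Fin.suc j)          ≡⟨ lookup-tail (E i) ⟩
    Vec.lookup (Vec.tail (E i)) j         ≡⟨ cong (λ v → Vec.lookup v j) (step i) ⟩
    Vec.lookup (Vec.init (E (suc i))) j   ≡⟨ lookup-init (E (suc i)) j ⟩
    Vec.lookup (E (suc i)) (inject₁ j)    ≡⟨ lookup-window t (suc i) (inject₁ j)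
                                                (≡.trans (Fin.toℕ-inject₁ j) (suc-injective eq)) ⟩
    Vec.head (E (suc i + t))              ≡⟨ cong (Vec.head ∘ E) (+-suc i t) ⟨
    Vec.head (E (i + suc t))              ∎
    where
    lookup-tail : ∀ v → Vec.lookup v (Fin.suc j) ≡ Vec.lookup (Vec.tail v) j
    lookup-tail (x ∷ v) = refl

  -- The subword at i starts with the letter of index i + 1, so the letters are shifted by one.
  word : Vec A N
  word = Vec.tabulate λ j → Vec.head (E (toℕ j + pred N))

  subword-word : ∀ i → subword word i ≡ E (toℕ i)
  subword-word i = ≡.trans (Vec.tabulate-cong letter) (Vec.tabulate∘lookup (E (toℕ i)))
    where
    -- The shift by 1 in `subword` and the shift by N - 1 in `word` add up to N.
    shifted : ∀ x → (toℕ ((toℕ i + suc x) mod N) + pred N) % N ≡ (toℕ i + x) % N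
    shifted x = begin
      (toℕ ((toℕ i + suc x) mod N) + pred N) % N  ≡⟨ cong (λ r → (r + pred N) % N) (toℕ-mod (toℕ i + suc x) N) ⟩
      ((toℕ i + suc x) % N + pred N) % N          ≡⟨ [m%n+o]%n≡[m+o]%n (toℕ i + suc x) N (pred N) ⟩
      (toℕ i + suc x + pred N) % N                ≡⟨ cong (λ y → (y + pred N) % N) (+-suc (toℕ i) x) ⟩
      suc (toℕ i + x + pred N) % N                ≡⟨ cong (_% N) (+-suc (toℕ i + x) (pred N)) ⟨
      (toℕ i + x + suc (pred N)) % N              ≡⟨ cong (λ y → (toℕ i + x + y) % N) (suc-pred N) ⟩
      (toℕ i + x + N) % N                         ≡⟨ [m+n]%n≡m%n (toℕ i + x) N ⟩
      (toℕ i + x) % N                             ∎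
    letter : ∀ j → Vec.lookup word ((toℕ i + suc (toℕ j)) mod N) ≡ Vec.lookup (E (toℕ i)) j
    letter j = begin
      Vec.lookup word ((toℕ i + suc (toℕ j)) mod N)                    ≡⟨ Vec.lookup∘tabulate _ ((toℕ i + suc (toℕ j)) mod N) ⟩
      Vec.head (E (toℕ ((toℕ i + suc (toℕ j)) mod N) + pred N))        ≡⟨ cong Vec.head (periodic (shifted (toℕ j))) ⟩
      Vec.head (E (toℕ i + toℕ j))                                     ≡⟨ lookup-window (toℕ j) (toℕ i) j refl ⟨
      Vec.lookup (E (toℕ i)) j                                         ∎

-- From lists back to weak orders.

unique-map : ∀ {A B : Set} {P : Pred A 0ℓ} {f : A → B} → (∀ {x y} → P x → P y → f x ≡ f y → x ≡ y) →
             ∀ {xs} → All P xs → Unique xs → Unique (List.map f xs)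
unique-map inj []         []         = []
unique-map inj (Px ∷ Pxs) (x∉ ∷ uxs) =
  All.map⁺ (All.zipWith (λ (Py , x≢y) eq → x≢y (inj Px Py eq)) (Pxs , x∉)) ∷ unique-map inj Pxs uxs

unique-lookup : ∀ {A : Set} {xs : List A} → Unique xs → ∀ i j → List.lookup xs i ≡ List.lookup xs j → i ≡ j
unique-lookup (x∉ ∷ _) Fin.zero    Fin.zero    _  = refl
unique-lookup (x∉ ∷ _) Fin.zero    (Fin.suc j) eq = contradiction eq (All.lookup x∉ (∈-lookup j))
unique-lookup (x∉ ∷ _) (Fin.suc i) Fin.zero    eq = contradiction (sym eq) (All.lookup x∉ (∈-lookup i))
unique-lookup (_ ∷ u)  (Fin.suc i) (Fin.suc j) eq = cong Fin.suc (unique-lookup u i j eq)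

height-≤ : ∀ {n h} (w : Vec ℕ n) → All (_≤ h) (Vec.toList w) → height w ≤ h
height-≤ []      []         = z≤n
height-≤ (x ∷ w) (x≤ ∷ w≤) = ⊔-lub x≤ (height-≤ w w≤)

≤-height : ∀ {n} (w : Vec ℕ n) → All (_≤ height w) (Vec.toList w)
≤-height []      = []
≤-height (x ∷ w) = m≤m⊔n x (height w) ∷ All.map (λ y≤ → ≤-trans y≤ (m≤n⊔m x (height w))) (≤-height w)

height-unique : ∀ {n h} (w : Vec ℕ n) → All (_≤ h) (Vec.toList w) → h ∈ Vec.toList w → height w ≡ h
height-unique w w≤ h∈ = ≤-antisym (height-≤ w w≤) (All.lookup (≤-height w) h∈)

letters-bounds : ∀ {n h} (w : Vec ℕ n) → (∀ x → x Vec.∈ w ⇔ x ≤ h) →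
                 All (_≤ h) (Vec.toList w) × All (_∈ Vec.toList w) (upTo (suc h))
letters-bounds w letter =
  All.tabulate (to _ ∘ ∈-toList⁻) , All.tabulate (∈-toList⁺ ∘ from _ ∘ s≤s⁻¹ ∘ ∈-upTo⁻)
  where open module L x = Equivalence (letter x)

sum-toList : ∀ {n} (w : Vec ℕ n) → sum (Vec.toList w) ≡ Vec.sum w
sum-toList []      = refl
sum-toList (x ∷ w) = cong (x +_) (sum-toList w)

prefix-toList : ∀ {n} (w : Vec ℕ (suc n)) → prefix n (Vec.toList w) ≡ Vec.init w
prefix-toList {zero}  (x ∷ [])    = refl
prefix-toList {suc n} (x ∷ y ∷ w) = cong (x ∷_) (prefix-toList (y ∷ w))

vector : ∀ {A : Set} {n} (xs : List A) → length xs ≡ n → ∃[ w ] Vec.toList {n = n} w ≡ xs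
vector xs refl = Vec.fromList xs , Vec.toList∘fromList xs

module _ {p k h : ℕ} where

  open Words p k h

  𝒲⇒Word : ∀ {w} → 𝒲 k n h w → Word (Vec.toList w)
  𝒲⇒Word {w} ((h′ , _ , letter) , height≡ , weight≡)
    with bound , onto ← letters-bounds w letter
    -- The bound `h′` of the weak order is its largest letter, hence equals the height `h`.
    with refl ← ≡.trans (sym (height-unique w bound (All.lookup onto (∈-upTo⁺ ≤-refl)))) height≡ =
    Vec.length-toList w , bound , onto , ≡.trans (sum-toList w) weight≡

  Word⇒𝒲 : h < n → ∀ {w} → Word (Vec.toList w) → 𝒲 k n h w
  Word⇒𝒲 h<n {w} (_ , bound , onto , wt) =
    (h , h<n , λ x → mk⇔ (All.lookup bound ∘ ∈-toList⁺) (∈-toList⁻ ∘ All.lookup onto ∘ ∈-upTo⁺ ∘ s≤s)) ,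
    height-unique w bound (All.lookup onto (∈-upTo⁺ ≤-refl)) ,
    ≡.trans (sym (sum-toList w)) wt

  𝒲⁻⇒Word : ∀ {u} → 𝒲⁻ k n h u → ∃[ xs ] Word xs × prefix (suc p) xs ≡ u
  𝒲⁻⇒Word (w , w∈ , refl) = Vec.toList w , 𝒲⇒Word w∈ , prefix-toList w

  Word⇒𝒲⁻ : h < n → ∀ {xs} → Word xs → 𝒲⁻ k n h (prefix (suc p) xs)
  Word⇒𝒲⁻ h<n {xs} xs∈@(len , _) with w , refl ← vector xs len =
    w , Word⇒𝒲 h<n xs∈ , sym (prefix-toList w)

  prefix-injective : ∀ {xs ys} → Word xs → Word ys → prefix (suc p) xs ≡ prefix (suc p) ys → xs ≡ ys
  prefix-injective (len , _ , _ , wt) (len′ , _ , _ , wt′) eq =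
    prefix-sum-injective (suc p) len len′ eq (≡.trans wt (sym wt′))

  cardinality : h < n → ∀ {xs} → Unique xs → (∀ x → x ∈ xs ⇔ Word x) → HasCardinality (𝒲⁻ k n h) (length xs)
  cardinality h<n {xs} unique xs⇔Word =
    List.map (prefix (suc p)) xs ,
    unique-map prefix-injective (All.tabulate (λ {x} → to x)) unique ,
    List.length-map (prefix (suc p)) xs ,
    λ u → mk⇔ (member u) (listed u)
    where
    open module X x = Equivalence (xs⇔Word x)
    member : ∀ u → u ∈ List.map (prefix (suc p)) xs → 𝒲⁻ k n h u
    member u u∈ with x , x∈ , refl ← ∈-map⁻ (prefix (suc p)) u∈ = Word⇒𝒲⁻ h<n (to x x∈)
    listed : ∀ u → 𝒲⁻ k n h u → u ∈ List.map (prefix (suc p)) xs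
    listed u u∈ with x , wx , refl ← 𝒲⁻⇒Word u∈ = ∈-map⁺ (prefix (suc p)) (from x wx)

  -- The universal cycle of an Eulerian circuit.

  -- The window at i is the prefix of the i-th arc. A string is the prefix of exactly one word, and
  -- that word occupies exactly one place in the circuit.
  universal-cycle : h < n → ∀ {v} xs → Walk v xs v → Unique xs → (∀ x → x ∈ xs ⇔ Word x) →
                    ∃[ s ] IsUniversalCycle (𝒲⁻ k n h) {length xs} s
  universal-cycle h<n [] _ unique xs⇔Word =
    [] , cardinality h<n unique xs⇔Word ,
    λ u u∈ → contradiction (Equivalence.from (xs⇔Word _) (proj₁ (proj₂ (𝒲⁻⇒Word u∈)))) λ ()
  universal-cycle h<n xs@(x₀ ∷ xs′) walk@(start ∷ _) unique xs⇔Word =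
    word , cardinality h<n unique xs⇔Word , occurs
    where
    N = length xs
    open module X x = Equivalence (xs⇔Word x)

    arc : ℕ → List ℕ
    arc i = List.lookup xs (i mod N)

    arc-word : ∀ i → Word (arc i)
    arc-word i = to _ (∈-lookup (i mod N))

    -- The closed walk wraps from its last arc to its first exactly when i % N = N − 1.
    follows : ∀ i → prefix p (rot (arc i)) ≡ prefix p (arc (suc i))
    follows i with m≤n⇒m<n∨m≡n (m%n<n i N)
    ... | inj₁ r<N = walk-step walk (i mod N) (suc i mod N) (begin
        toℕ (suc i mod N)   ≡⟨ toℕ-mod (suc i) N ⟩
        suc i % N           ≡⟨ [1+m%n]%n≡[1+m]%n i N ⟨
        suc (i % N) % N     ≡⟨ m<n⇒m%n≡m r<N ⟩
        suc (i % N)         ≡⟨ cong suc (toℕ-mod i N) ⟨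
        suc (toℕ (i mod N)) ∎)
      where
      open ≡-Reasoning
    ... | inj₂ r≡N = begin
        prefix p (rot (arc i)) ≡⟨ walk-end walk (i mod N) (≡.trans (cong suc (toℕ-mod i N)) r≡N) ⟩
        _                      ≡⟨ start ⟨
        prefix p x₀            ≡⟨ cong (prefix p ∘ List.lookup xs) (mod-cong {0} {suc i} {N} zero≡) ⟩
        prefix p (arc (suc i)) ∎
      where
      open ≡-Reasoning
      zero≡ : 0 % N ≡ suc i % N
      zero≡ = begin
        0 % N           ≡⟨ n%n≡0 N ⟨
        N % N           ≡⟨ cong (_% N) r≡N ⟨
        suc (i % N) % N ≡⟨ [1+m%n]%n≡[1+m]%n i N ⟩
        suc i % N       ∎

    open OverlappingWindows {N = N} (prefix (suc p) ∘ arc)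
      (λ {i} {j} eq → cong (prefix (suc p) ∘ List.lookup xs) (mod-cong {i} {j} eq))
      (λ i → ≡.trans (tail-prefix p {arc i} (proj₁ (arc-word i)))
               (≡.trans (follows i) (sym (init-prefix p (arc (suc i))))))

    subword-lookup : ∀ i → subword word i ≡ prefix (suc p) (List.lookup xs i)
    subword-lookup i = ≡.trans (subword-word i) (cong (prefix (suc p) ∘ List.lookup xs) (toℕ-mod-id i))

    occurs : ∀ u → 𝒲⁻ k n h u → ∃! _≡_ λ i → subword word i ≡ u
    occurs u u∈ with x , wx , refl ← 𝒲⁻⇒Word u∈ =
      index x∈ , ≡.trans (subword-lookup (index x∈)) (cong (prefix (suc p)) (sym (lookup-index x∈))) ,
      λ {i} eq → unique-lookup unique (index x∈) i
        (≡.trans (sym (lookup-index x∈))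
          (prefix-injective wx (to _ (∈-lookup i)) (≡.trans (sym eq) (subword-lookup i))))
      where x∈ = from x wx

theorem3p9 : ∀ (n k h : ℕ) .{{_ : NonZero n}} .{{_ : NonZero k}} →
    k ≤ n C 2 → 0 ≤ h → h < n →
    ∃[ N ] ∃[ s ] IsUniversalCycle (𝒲⁻ k n h) {N} s
-- As `1 C 2` is 0, no positive `k` is possible; from n = 2 on, vertices of length n - 2 exist.
theorem3p9 (suc zero)    (suc k) h () _ _
theorem3p9 (suc (suc p)) k       h _  _ h<n
  with T , T⇔Word ← Words.circuit p k h =
  _ , universal-cycle h<n (arcs T) (walk T) (unique T) T⇔Word
  where open Words.Circuit p k h
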